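{- Let $\mathbf{f}$ be the Fibonacci word and let $\mathbf{cubes_f}$ be the infinite binary word whose $n$-th term ($n\ge 0$) is $1$ if a cube ends at position $n$ of $\mathbf{f}$ and $0$ otherwise. Then: \begin{itemize} \item the runs of $0$'s in $\mathbf{cubes_f}$ of length $8$ begin exactly at the positions $i$ with $(i)_F\in(10)^+0001$; \item the runs of $0$'s in $\mathbf{cubes_f}$ of length $7$ begin exactly at the positions $i$ with $(i)_F\in(10)^+01001$. \end{itemize}
   Context: The Fibonacci word is $\mathbf{f}=010010100100101001010010\cdots$, the fixed point of the morphism $0\mapsto 01$, $1\mapsto 0$; its letters are indexed starting from position $0$, and $\mathbf{f}[a..b]$ denotes the factor occupying positions $a$ through $b$. A cube is a word of the form $xxx$ with $x$ nonempty. A cube ends at position $j$ of $\mathbf{f}$ if there exist $i\ge 0$ and $m\ge 1$ with $j=i+3m-1$ such that $\mathbf{f}[i..j]=xxx$ for some word $x$ of length $m$. A run of $0$'s of length $\ell\ge1$ beginning at position $i$ in a binary word $\mathbf{u}=u_0u_1\cdots$ means $u_i=\cdots=u_{i+\ell-1}=0$, $u_{i+\ell}=1$, and either $i=0$ or $u_{i-1}=1$. Fibonacci numbers: $F_0=0$, $F_1=1$, $F_{k+2}=F_{k+1}+F_k$. For $n\ge0$, $(n)_F$ is the canonical Fibonacci (Zeckendorf) representation of $n$: the unique binary word $d_k\cdots d_2$ (most significant digit first), with no leading $0$ and no two consecutive $1$'s, such that $n=\sum_j d_jF_j$ (the last digit has weight $F_2=1$). In the regular expressions, $(10)^+$ denotes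 one or more repetitions of $10$. -}

module Defs where

open import Data.Nat using (ℕ; zero; suc; _+_; _*_; _∸_; _<_; _≤_)
open import Data.Bool using (Bool; true; false)
open import Data.List using (List; []; _∷_; _++_; concatMap; length)
open import Data.Product using (Σ; ∃; _×_; _,_)
open import Data.Sum using (_⊎_)
open import Relation.Binary.PropositionalEquality using (_≡_)
open import Function using (_∘_)

-- Letters / digits: false = 0, true = 1.

fib : ℕ → ℕ
fib zero = 0
fib (suc zero) = 1
fib (suc (suc k)) = fib (suc k) + fib k

φ : List Bool → List Bool
φ = concatMap (λ { false → false ∷ true ∷ [] ; true → false ∷ [] })

iter : ℕ → List Bool → List Bool
iter zero w = w
iter (suc k) w = φ (iter k w)

-- lookup with a default (never used below: see fibWord)
at : List Bool → ℕ → Bool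
at [] _ = false
at (x ∷ xs) zero = x
at (x ∷ xs) (suc n) = at xs n

-- The Fibonacci word f = lim φ^k(0), indexed from 0.
-- φ^(n+1)(0) is a prefix of f of length F_{n+3} > n, so position n is read there.
fibWord : ℕ → Bool
fibWord n = at (iter (suc n) (false ∷ [])) n

-- A cube xxx with |x| = m ≥ 1 occupies f[i .. i+3m-1].
CubeEndsAt : ℕ → Set
CubeEndsAt j = Σ ℕ λ i → Σ ℕ λ m → (1 ≤ m) × (j + 1 ≡ i + 3 * m) ×
  (∀ t → t < m → (fibWord (i + t) ≡ fibWord (i + m + t))
                × (fibWord (i + t) ≡ fibWord (i + 2 * m + t)))

RunOfZeros : (ℕ → Bool) → ℕ → ℕ → Set
RunOfZeros u ℓ i =
  (∀ t → t < ℓ → u (i + t) ≡ false) × (u (i + ℓ) ≡ true) ×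
  (i ≡ 0 ⊎ Σ ℕ λ p → (i ≡ suc p) × (u p ≡ true))

-- Value of a digit word d_k ⋯ d_2 (most significant first, last weight F₂)
val : List Bool → ℕ
val [] = 0
val (false ∷ ds) = val ds
val (true ∷ ds) = fib (length ds + 2) + val ds

NoLeadingZero : List Bool → Set
NoLeadingZero [] = Data.Unit.⊤ where import Data.Unit
NoLeadingZero (d ∷ _) = d ≡ true

No11 : List Bool → Set
No11 [] = Data.Unit.⊤ where import Data.Unit
No11 (x ∷ []) = Data.Unit.⊤ where import Data.Unit
No11 (true ∷ true ∷ _) = Data.Empty.⊥ where import Data.Empty
No11 (_ ∷ y ∷ ys) = No11 (y ∷ ys)

IsRepF : ℕ → List Bool → Set
IsRepF n w = NoLeadingZero w × No11 w × (val w ≡ n)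

rep10 : ℕ → List Bool
rep10 zero = []
rep10 (suc k) = true ∷ false ∷ rep10 k

RepIn10+ : List Bool → ℕ → Set
RepIn10+ s n = Σ (List Bool) λ w → IsRepF n w ×
  Σ ℕ λ k → (1 ≤ k) × (w ≡ rep10 k ++ s)

suffix8 : List Bool
suffix8 = false ∷ false ∷ false ∷ true ∷ []

suffix7 : List Bool
suffix7 = false ∷ true ∷ false ∷ false ∷ true ∷ []

{-# OPTIONS --safe #-}
module Submission where

-- Let S k be the position in f at which the block φ(f_k) starts; on Zeckendorf
-- representations S appends a 0.  A cube xxx with |x| ≥ 3, even with its last two
-- letters missing, desubstitutes to such a word of smaller period, so the
-- period of a cube is a Fibonacci number F_N.  The words f and f shifted by F_N differ
-- exactly in the two letters to the left of each position S^N(k) + F_{N+1}: they read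
-- 01 in one word and 10 in the other, and φ maps such a pair to another one.  Hence the
-- cubes of period F_N (N ≥ 4) are those inside the gaps between these pairs, and there
-- is one for each k with f_k = 0.
-- Some cube ends at S^4(k) − 3 for every k ≥ 1 unless S^4(k) is a Fibonacci number.
-- As the cuts S^4(k) are 5 or 8 apart, this confines long runs without cube ends to the
-- neighbourhood of a Fibonacci number F_M, M ≥ 8, where they are F_M − 7, …, F_M − 1 for odd M
-- and F_M − 7, …, F_M for even M.

open import Defs
open import Data.Bool using (Bool; true; false; not)
open import Data.Bool.Properties using (not-injective; not-involutive; not-¬)
open import Data.Empty using (⊥; ⊥-elim)
open import Data.List using (List; []; _∷_; _++_; length)
open import Data.List.Properties using (length-++)
open import Data.Nat hiding (parity)
open import Data.Nat.Induction using (<-wellFounded)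
open import Data.Nat.Properties
open import Data.Nat.Tactic.RingSolver using (solve-∀)
open import Data.Product using (Σ; ∃; _×_; _,_; proj₁; proj₂)
open import Data.Sum using (_⊎_; inj₁; inj₂)
open import Data.Unit using (tt)
open import Function using (_∘_)
open import Function.Bundles using (_⇔_; mk⇔; Equivalence)
open import Function.Construct.Composition using (_⇔-∘_)
open import Function.Construct.Symmetry using (⇔-sym)
open import Induction.WellFounded using (Acc; acc)
open import Relation.Binary.Definitions using (tri<; tri≈; tri>; Tri)
open import Relation.Binary.PropositionalEquality
open import Relation.Nullary using (yes; no)

-- Linear arithmetic and letters

infixr 6 _⊕_

_⊕_ : ∀ {a b c d} → a ≤ b → c ≤ d → a + c ≤ b + d
_⊕_ = +-mono-≤

-- Linear arithmetic: X ≤ Y is the sum of the hypotheses, c the slack, and the equation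
-- is a semiring identity obtained by moving all terms to the side where they are positive.
linear : ∀ c {X Y L R} → X ≤ Y → c + (L + Y) ≡ R + X → L ≤ R
linear c {X} {Y} {L} {R} X≤Y eq = +-cancelʳ-≤ Y L R (begin
  L + Y        ≤⟨ m≤n+m (L + Y) c ⟩
  c + (L + Y)  ≡⟨ eq ⟩
  R + X        ≤⟨ +-monoʳ-≤ R X≤Y ⟩
  R + Y        ∎)
  where open ≤-Reasoning

linear-⊥ : ∀ c {X Y} → X ≤ Y → c + suc Y ≡ X → ⊥
linear-⊥ c X≤Y eq with linear c {L = 1} {R = 0} X≤Y eq
... | ()

false≢true : ∀ {b} → b ≡ false → b ≡ true → ⊥
false≢true refl ()

≢true⇒false : ∀ {b} → (b ≡ true → ⊥) → b ≡ false
≢true⇒false {false} _ = refl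
≢true⇒false {true} h = ⊥-elim (h refl)

letter : ∀ b → b ≡ false ⊎ b ≡ true
letter false = inj₁ refl
letter true = inj₂ refl

-- Block lengths, increasing sequences, Fibonacci bounds

len : Bool → ℕ
len false = 2
len true = 1

len-pos : ∀ b → 1 ≤ len b
len-pos false = s≤s z≤n
len-pos true = ≤-refl

blockStart : (ℕ → Bool) → ℕ → ℕ
blockStart f zero = 0
blockStart f (suc k) = len (f k) + blockStart f k

locate : (g : ℕ → ℕ) → (∀ k → g k < g (suc k)) → ∀ t →
  t < g 0 ⊎ ∃ λ k → g k ≤ t × t < g (suc k)
locate g inc zero with g 0 in eq
... | zero = inj₂ (0 , ≤-reflexive eq , subst (_< g 1) eq (inc 0))
... | suc _ = inj₁ z<s
locate g inc (suc t) with locate g inc t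
... | inj₁ t<g₀ with m≤n⇒m<n∨m≡n t<g₀
...   | inj₁ lt = inj₁ lt
...   | inj₂ eq = inj₂ (0 , ≤-reflexive (sym eq) , subst (_< g 1) (sym eq) (inc 0))
locate g inc (suc t) | inj₂ (k , lo , hi) with m≤n⇒m<n∨m≡n hi
...   | inj₁ lt = inj₂ (k , m≤n⇒m≤1+n lo , lt)
...   | inj₂ eq = inj₂ (suc k , ≤-reflexive (sym eq) , subst (_< g (2 + k)) (sym eq) (inc (suc k)))

monotone : (g : ℕ → ℕ) → (∀ k → g k < g (suc k)) → ∀ {x y} → x ≤ y → g x ≤ g y
monotone g inc {x} {y} x≤y = go (≤⇒≤′ x≤y)
  where
  go : ∀ {y} → x ≤′ y → g x ≤ g y
  go ≤′-refl = ≤-refl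
  go (≤′-step p) = ≤-trans (go p) (<⇒≤ (inc _))

monotone-cancel-< : (g : ℕ → ℕ) → (∀ k → g k < g (suc k)) → ∀ {x y} → g x < g y → x < y
monotone-cancel-< g inc {x} {y} lt = ≰⇒> λ y≤x → <⇒≱ lt (monotone g inc y≤x)

fib-pos : ∀ n → 1 ≤ fib (1 + n)
fib-pos zero = ≤-refl
fib-pos (suc n) = ≤-trans (fib-pos n) (m≤m+n _ _)

fib-mono : ∀ {m n} → m ≤ n → fib (1 + m) ≤ fib (1 + n)
fib-mono {m} m≤n = go (≤⇒≤′ m≤n)
  where
  go : ∀ {n} → m ≤′ n → fib (1 + m) ≤ fib (1 + n)
  go ≤′-refl = ≤-refl
  go (≤′-step {n} p) = ≤-trans (go p) (m≤m+n _ _)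

-- Words fixed by φ and their block starts

module Structure
  (f : ℕ → Bool)
  (f0 : f 0 ≡ false)
  -- With `f-S+1` this says that f is fixed by φ: from each block start on, f reads the block 01 or
  -- 0.
  (f-S : ∀ k → f (blockStart f k) ≡ false)
  (f-S+1 : ∀ k → f k ≡ false → f (suc (blockStart f k)) ≡ true)
  where

  S : ℕ → ℕ
  S = blockStart f

  S-suc : ∀ {k b} → f k ≡ b → S (suc k) ≡ len b + S k
  S-suc {k} e = cong (λ b → len b + S k) e

  f-next : ∀ {k b} → f k ≡ b → f (suc (S k)) ≡ not b
  f-next {k} {false} e = f-S+1 k e
  f-next {k} {true} e = trans (cong f (sym (S-suc e))) (f-S (suc k))

  -- φ sends 01 to 010 and 10 to 001: behind the common first 0 the pair reappears with its letters
  -- exchanged.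
  f-next₂ : ∀ {k b} → f k ≡ b → f (suc k) ≡ not b → f (2 + S k) ≡ b
  f-next₂ {k} {false} e _ = trans (cong f (sym (S-suc e))) (f-S (suc k))
  f-next₂ {k} {true} e e′ = trans (cong (f ∘ suc) (sym (S-suc e))) (f-next e′)

  data Position : ℕ → Set where
    start : ∀ k → Position (S k)
    inner : ∀ k → f k ≡ false → Position (suc (S k))

  position : ∀ t → Position t
  position zero = start 0
  position (suc t) with position t
  ... | inner k e = subst Position (S-suc e) (start (suc k))
  ... | start k with letter (f k)
  ...   | inj₁ e = inner k e
  ...   | inj₂ e = subst Position (S-suc e) (start (suc k))

  startOf : ∀ {t} → f t ≡ false → ∃ λ k → t ≡ S k
  startOf {t} e with position t
  ... | start k = k , refl
  ... | inner k e′ = ⊥-elim (false≢true e (f-S+1 k e′))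

  innerOf : ∀ {t} → f t ≡ true → ∃ λ k → t ≡ suc (S k) × f k ≡ false
  innerOf {t} e with position t
  ... | start k = ⊥-elim (false≢true (f-S k) e)
  ... | inner k e′ = k , refl , e′

  no-11 : ∀ {t} → f t ≡ true → f (suc t) ≡ false
  no-11 e with innerOf e
  ... | k , refl , e′ = trans (cong f (sym (S-suc e′))) (f-S (suc k))

  before-1 : ∀ {t} → f (suc t) ≡ true → f t ≡ false
  before-1 {t} e = ≢true⇒false λ e′ → false≢true (no-11 e′) e

  no-000 : ∀ {t} → f t ≡ false → f (suc t) ≡ false → f (2 + t) ≡ true
  no-000 e e₁ with startOf e
  ... | k , refl with letter (f k)
  ...   | inj₁ h = ⊥-elim (false≢true e₁ (f-next h))
  ...   | inj₂ h = trans (cong (f ∘ suc) (sym (S-suc h))) (f-next (no-11 h))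

  S-step : ∀ k → S k < S (suc k)
  S-step k with f k
  ... | false = m<n⇒m<1+n ≤-refl
  ... | true = ≤-refl

  S-mono : ∀ {x y} → x ≤ y → S x ≤ S y
  S-mono = monotone S S-step

  S-mono-< : ∀ {x y} → x < y → S x < S y
  S-mono-< {x} x<y = ≤-trans (S-step x) (S-mono x<y)

  S-cancel-< : ∀ {x y} → S x < S y → x < y
  S-cancel-< = monotone-cancel-< S S-step

  S-expanding : ∀ k → 1 ≤ k → k < S k
  S-expanding (suc zero) _ rewrite f0 = ≤-refl
  S-expanding (suc (suc k)) _ = ≤-trans (s≤s (S-expanding (suc k) z<s)) (S-step (suc k))

  -- `S t` is t plus the number of zeros among the first t letters, and the k blocks before `S k`
  -- contain one 0 each.
  S-S : ∀ k → S (S k) ≡ S k + k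
  S-S zero = refl
  S-S (suc k) with f k in e
  ... | false rewrite f-next e | f-S k | S-S k = sym (cong (2 +_) (+-suc (S k) k))
  ... | true rewrite f-S k | S-S k = cong suc (sym (+-suc (S k) k))

  S^ : ℕ → ℕ → ℕ
  S^ zero k = k
  S^ (suc n) k = S (S^ n k)

  S^-S : ∀ n k → S^ n (S k) ≡ S^ (suc n) k
  S^-S zero k = refl
  S^-S (suc n) k = cong S (S^-S n k)

  S^-+ : ∀ m n k → S^ m (S^ n k) ≡ S^ (m + n) k
  S^-+ zero n k = refl
  S^-+ (suc m) n k = cong S (S^-+ m n k)

  S^-0 : ∀ n → S^ n 0 ≡ 0
  S^-0 zero = refl
  S^-0 (suc n) = cong S (S^-0 n)

  -- The increments are the lengths of φ^n(0) and φ^n(1).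
  S^-suc-0 : ∀ n {k} → f k ≡ false → S^ n (suc k) ≡ S^ n k + fib (2 + n)
  S^-suc-1 : ∀ n {k} → f k ≡ true → S^ n (suc k) ≡ S^ n k + fib (1 + n)

  S^-suc-0 zero {k} e = sym (+-comm k 1)
  S^-suc-0 (suc n) {k} e = begin
    S^ (suc n) (suc k)                          ≡⟨ S^-S n (suc k) ⟨
    S^ n (S (suc k))                            ≡⟨ cong (S^ n) (S-suc e) ⟩
    S^ n (2 + S k)                              ≡⟨ S^-suc-1 n (f-next e) ⟩
    S^ n (suc (S k)) + fib (1 + n)              ≡⟨ cong (_+ fib (1 + n)) (S^-suc-0 n (f-S k)) ⟩
    S^ n (S k) + fib (2 + n) + fib (1 + n)      ≡⟨ +-assoc (S^ n (S k)) _ _ ⟩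
    S^ n (S k) + fib (3 + n)                    ≡⟨ cong (_+ fib (3 + n)) (S^-S n k) ⟩
    S^ (suc n) k + fib (3 + n)                  ∎
    where open ≡-Reasoning

  S^-suc-1 zero {k} e = sym (+-comm k 1)
  S^-suc-1 (suc n) {k} e = begin
    S^ (suc n) (suc k)          ≡⟨ S^-S n (suc k) ⟨
    S^ n (S (suc k))            ≡⟨ cong (S^ n) (S-suc e) ⟩
    S^ n (suc (S k))            ≡⟨ S^-suc-0 n (f-S k) ⟩
    S^ n (S k) + fib (2 + n)    ≡⟨ cong (_+ fib (2 + n)) (S^-S n k) ⟩
    S^ (suc n) k + fib (2 + n)  ∎
    where open ≡-Reasoning

  S^-step : ∀ n k → S^ n k < S^ n (suc k)
  S^-step zero k = ≤-refl
  S^-step (suc n) k = S-mono-< (S^-step n k)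

  S^-mono : ∀ n {x y} → x ≤ y → S^ n x ≤ S^ n y
  S^-mono n = monotone (S^ n) (S^-step n)

  S^-1 : ∀ n → S^ n 1 ≡ fib (2 + n)
  S^-1 n = trans (S^-suc-0 n f0) (cong (_+ fib (2 + n)) (S^-0 n))

  S^-fib : ∀ m n → S^ m (fib (2 + n)) ≡ fib (2 + (m + n))
  S^-fib m n = begin
    S^ m (fib (2 + n))  ≡⟨ cong (S^ m) (S^-1 n) ⟨
    S^ m (S^ n 1)       ≡⟨ S^-+ m n 1 ⟩
    S^ (m + n) 1        ≡⟨ S^-1 (m + n) ⟩
    fib (2 + (m + n))   ∎
    where open ≡-Reasoning

  -- Pairs of letters in which f and its Fibonacci shifts differ

  S-fib-shift : ∀ n p → S (p + fib (2 + n)) ≡ S p + fib (3 + n) →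
    S (S (p + fib (2 + n))) ≡ S (S p) + fib (4 + n)
  S-fib-shift n p e = begin
    S (S (p + fib (2 + n)))                      ≡⟨ S-S (p + fib (2 + n)) ⟩
    S (p + fib (2 + n)) + (p + fib (2 + n))      ≡⟨ cong (_+ (p + fib (2 + n))) e ⟩
    S p + fib (3 + n) + (p + fib (2 + n))        ≡⟨ rearrange (S p) (fib (3 + n)) p (fib (2 + n)) ⟩
    S p + p + fib (4 + n)                        ≡⟨ cong (_+ fib (4 + n)) (S-S p) ⟨
    S (S p) + fib (4 + n)                        ∎
    where
    open ≡-Reasoning
    rearrange : ∀ a b c d → a + b + (c + d) ≡ a + c + (b + d)
    rearrange = solve-∀

  -- P n k is the first position of the k-th pair of letters in which f and f shifted by
  -- fib (2 + n) differ; par n is the letter of f there.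
  P : ℕ → ℕ → ℕ
  P zero k = S (S k)
  P (suc n) k = suc (S (P n k))

  par : ℕ → Bool
  par zero = false
  par (suc n) = not (par n)

  -- The field `shift` drives the induction on n: the blocks of the letters at p and q again start a
  -- Fibonacci number apart.
  record Swap (n k : ℕ) : Set where
    p = P n k
    q = p + fib (2 + n)
    field
      at-p  : f p ≡ par n
      at-p₁ : f (suc p) ≡ not (par n)
      at-q  : f q ≡ not (par n)
      at-q₁ : f (suc q) ≡ par n
      shift : S q ≡ S p + fib (3 + n)

  -- At level 0 the factor 010 at `S (S k)`, compared with itself one letter on, gives 01 against
  -- 10. By `f-next` and `f-next₂`, φ turns such a pair into another one, one letter after the block
  -- start.
  swap : ∀ n k → Swap n k
  swap zero k = record
    { at-p = f-S (S k)
    ; at-p₁ = f-next (f-S k)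
    ; at-q = trans (cong f (+-comm (S (S k)) 1)) (f-next (f-S k))
    ; at-q₁ = trans (cong (f ∘ suc) (+-comm (S (S k)) 1)) (no-11 (f-next (f-S k)))
    ; shift = trans (cong S (+-comm (S (S k)) 1))
        (trans (S-suc (f-S (S k))) (+-comm 2 (S (S (S k)))))
    }
  swap (suc n) k = record
    { at-p = f-next at-p
    ; at-p₁ = trans (f-next₂ at-p at-p₁) (sym (not-involutive (par n)))
    ; at-q = trans (cong f q′) (f-next at-q)
    ; at-q₁ = trans (cong (f ∘ suc) q′)
        (f-next₂ at-q (trans at-q₁ (sym (not-involutive (par n)))))
    ; shift = begin
        S (suc (S p + fib (3 + n)))  ≡⟨ cong S q′ ⟩
        S (suc (S q))                ≡⟨ S-suc (f-S q) ⟩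
        2 + S (S q)                  ≡⟨ cong (2 +_) (S-fib-shift n p shift) ⟩
        2 + S (S p) + fib (4 + n)    ≡⟨ cong (_+ fib (4 + n)) (S-suc (f-S p)) ⟨
        S (suc (S p)) + fib (4 + n)  ∎
    }
    where
    open ≡-Reasoning
    open Swap (swap n k)
    q′ : suc (S p + fib (3 + n)) ≡ suc (S q)
    q′ = cong suc (sym shift)

  S-2+P : ∀ n k → S (2 + P n k) ≡ 3 + S (P n k)
  S-2+P n k with par n | Swap.at-p (swap n k) | Swap.at-p₁ (swap n k)
  ... | false | e | e₁ = trans (S-suc e₁) (cong (1 +_) (S-suc e))
  ... | true | e | e₁ = trans (S-suc e₁) (cong (2 +_) (S-suc e))

  -- The pair of level 0 is the block of the letter at `S k`. As φ(01) and φ(10) both have length 3,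
  -- S carries the right end of a pair to that of the next level.
  P-cut : ∀ n k → 2 + P n k ≡ S^ (2 + n) k + fib (3 + n)
  P-cut n k = begin
    2 + P n k                             ≡⟨ cut n ⟩
    S^ (1 + n) (suc (S k))                ≡⟨ S^-suc-0 (1 + n) (f-S k) ⟩
    S^ (1 + n) (S k) + fib (3 + n)        ≡⟨ cong (_+ fib (3 + n)) (S^-S (1 + n) k) ⟩
    S^ (2 + n) k + fib (3 + n)            ∎
    where
    open ≡-Reasoning
    cut : ∀ n → 2 + P n k ≡ S^ (1 + n) (suc (S k))
    cut zero = sym (S-suc (f-S k))
    cut (suc n) = trans (sym (S-2+P n k)) (cong S (cut n))

  Matches : ℕ → ℕ → Set
  Matches n t = f (t + fib (2 + n)) ≡ f t × S (t + fib (2 + n)) ≡ S t + fib (3 + n)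

  data Comparison (n : ℕ) : ℕ → Set where
    first   : ∀ k → Comparison n (P n k)
    second  : ∀ k → Comparison n (suc (P n k))
    matches : ∀ {t} → Matches n t → Comparison n t

  Matches-start : ∀ n t → S (t + fib (2 + n)) ≡ S t + fib (3 + n) → Matches (suc n) (S t)
  Matches-start n t e =
    trans (cong f (sym e)) (trans (f-S (t + fib (2 + n))) (sym (f-S t))) ,
    trans (cong S (sym e)) (S-fib-shift n t e)

  Matches-inner : ∀ n t → f t ≡ false → Matches n t → Matches (suc n) (suc (S t))
  Matches-inner n t e (fe , Se) =
    trans (cong (f ∘ suc) (sym Se)) (trans (f-next (trans fe e)) (sym (f-next e))) , (begin
      S (suc (S t + fib (3 + n)))    ≡⟨ cong (S ∘ suc) Se ⟨
      S (suc (S (t + fib (2 + n))))  ≡⟨ S-suc (f-S (t + fib (2 + n))) ⟩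
      2 + S (S (t + fib (2 + n)))    ≡⟨ cong (2 +_) (S-fib-shift n t Se) ⟩
      2 + S (S t) + fib (4 + n)      ≡⟨ cong (_+ fib (4 + n)) (S-suc (f-S t)) ⟨
      S (suc (S t)) + fib (4 + n)    ∎)
    where open ≡-Reasoning

  -- Position t lies in the block of some letter k, and the status of k one level down settles that
  -- of t. A block start matches unless it belongs to the second letter of a pair.
  comparison : ∀ n t → Comparison n t
  comparison zero t with position t
  ... | inner k e with startOf e
  ...   | j , refl = second j
  comparison zero t | start k with letter (f k)
  ...   | inj₂ e = matches
    ( trans (cong f (trans (+-comm (S k) 1) (sym (S-suc e)))) (trans (f-S (suc k)) (sym (f-S k)))
    , trans (cong S (+-comm (S k) 1)) (trans (S-suc (f-S k)) (+-comm 2 (S (S k)))))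
  ...   | inj₁ e with startOf e
  ...     | j , refl = first j
  comparison (suc n) t with position t
  comparison (suc n) t | start k with comparison n k
  ... | first j = matches (Matches-start n (P n j) (Swap.shift (swap n j)))
  ... | matches m = matches (Matches-start n k (proj₂ m))
  -- After a 0 the second block starts two letters on, after a 1 one letter on: at the second or
  -- first place of the new pair.
  ... | second j with letter (f (P n j))
  ...   | inj₁ e = subst (Comparison (suc n)) (sym (S-suc e)) (second j)
  ...   | inj₂ e = subst (Comparison (suc n)) (sym (S-suc e)) (first j)
  comparison (suc n) t | inner k e with comparison n k
  ... | first j = first j
  ... | matches m = matches (Matches-inner n k e m)
  ... | second j = subst (Comparison (suc n)) (cong suc (sym (S-suc p≡true))) (second j)
    where
    p≡true : f (P n j) ≡ true
    p≡true = trans (Swap.at-p (swap n j))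
      (not-injective (trans (sym (Swap.at-p₁ (swap n j))) e))

  -- Desubstitution and periods

  same-letter : ∀ {m} x y → S y ≡ S x + m → f (suc (S x)) ≡ f (suc (S x) + m) → f x ≡ f y
  same-letter {m} x y e e′ = not-injective (begin
    not (f x)          ≡⟨ f-next refl ⟨
    f (suc (S x))      ≡⟨ e′ ⟩
    f (suc (S x) + m)  ≡⟨ cong (f ∘ suc) e ⟨
    f (suc (S y))      ≡⟨ f-next refl ⟩
    not (f y)          ∎)
    where open ≡-Reasoning

  -- The word f[i .. i+3m-3] has period m: two letters short of a cube, which is what
  -- desubstitution preserves.
  PeriodicFrom : ℕ → ℕ → Set
  PeriodicFrom i m = ∀ t → i ≤ t → 3 + t ≤ i + (m + m) → f t ≡ f (t + m)

  -- The second equation says that f[i .. i+m-1] contains fib n zeros; it is what turns the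
  -- period fib (1 + n) into fib (2 + n) under φ.
  FibPeriod : ℕ → ℕ → Set
  FibPeriod i m = ∃ λ n → m ≡ fib (1 + n) × S (i + m) ≡ S i + fib (2 + n)

  -- Going right from a, alignment and equality support each other: if the blocks of x and x + d
  -- start m apart, `same-letter` gives equal letters, hence equal block lengths and alignment at
  -- the next x.
  desubstitute : ∀ a m d → 3 ≤ m → PeriodicFrom (S a) m → S (a + d) ≡ S a + m → PeriodicFrom a d
  desubstitute a m d 3≤m h e₀ x a≤x x≤ =
      same-letter′ x a≤x (bound x x≤) (shift x a≤x λ y y<x → bound y (≤-trans (+-monoʳ-≤ 3 (<⇒≤ y<x)) x≤))
    where
    same-letter′ : ∀ x → a ≤ x → 4 + S x ≤ S a + (m + m) → S (x + d) ≡ S x + m → f x ≡ f (x + d)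
    same-letter′ x a≤x x≤ e = same-letter x (x + d) e (h (suc (S x)) (m≤n⇒m≤1+n (S-mono a≤x)) x≤)

    shift′ : ∀ {x} → a ≤′ x → (∀ y → y < x → 4 + S y ≤ S a + (m + m)) → S (x + d) ≡ S x + m
    shift′ ≤′-refl bd = e₀
    shift′ (≤′-step {x} p) bd = begin
      len (f (x + d)) + S (x + d)  ≡⟨ cong (λ b → len b + S (x + d)) (same-letter′ x (≤′⇒≤ p) (bd x ≤-refl) IH) ⟨
      len (f x) + S (x + d)        ≡⟨ cong (len (f x) +_) IH ⟩
      len (f x) + (S x + m)        ≡⟨ +-assoc (len (f x)) (S x) m ⟨
      len (f x) + S x + m          ∎
      where
      open ≡-Reasoning
      IH = shift′ p (λ y y<x → bd y (m≤n⇒m≤1+n y<x))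

    shift : ∀ x → a ≤ x → (∀ y → y < x → 4 + S y ≤ S a + (m + m)) → S (x + d) ≡ S x + m
    shift x a≤x = shift′ (≤⇒≤′ a≤x)

    -- Alignment is carried across the first d letters, where `3 ≤ m` leaves room; so the blocks of
    -- 2d letters fill exactly 2m.
    S[a+2d] : S (a + (d + d)) ≡ S a + (m + m)
    S[a+2d] = begin
      S (a + (d + d))  ≡⟨ cong S (+-assoc a d d) ⟨
      S (a + d + d)    ≡⟨ shift (a + d) (m≤m+n a d) (λ y y<a+d →
                            linear 0 (S-mono-< y<a+d ⊕ ≤-reflexive e₀ ⊕
                              3≤m) (arith (S y) (S a) m (S (a + d)))) ⟩
      S (a + d) + m    ≡⟨ cong (_+ m) e₀ ⟩
      S a + m + m      ≡⟨ +-assoc (S a) m m ⟩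
      S a + (m + m)    ∎
      where
      open ≡-Reasoning
      arith : ∀ y a m z → 0 + (4 + y + (z + (a + m + m))) ≡ a + (m + m) + (suc y + (z + 3))
      arith = solve-∀

    -- Three consecutive letters include a 0, so their blocks fill at least 4 places; hence two
    -- missing letters stay two missing letters.
    three : ∀ x → 4 + S x ≤ S (3 + x)
    three x with f x in e
    ... | true rewrite no-11 e = +-monoˡ-≤ (3 + S x) (len-pos (f (2 + x)))
    ... | false with f (suc x)
    ...   | false = m≤n+m (4 + S x) (len (f (2 + x)))
    ...   | true = +-monoˡ-≤ (3 + S x) (len-pos (f (2 + x)))

    bound : ∀ x → 3 + x ≤ a + (d + d) → 4 + S x ≤ S a + (m + m)
    bound x x≤ = ≤-trans (three x) (≤-trans (S-mono x≤) (≤-reflexive S[a+2d]))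

  FibPeriod-shift : ∀ {x m} → f x ≡ false → f (x + m) ≡ false → FibPeriod x m → FibPeriod (suc x) m
  FibPeriod-shift {x} {m} e e′ (n , m≡ , shift) = n , m≡ , (begin
    S (suc (x + m))            ≡⟨ S-suc e′ ⟩
    2 + S (x + m)              ≡⟨ cong (2 +_) shift ⟩
    2 + S x + fib (2 + n)      ≡⟨ cong (_+ fib (2 + n)) (S-suc e) ⟨
    S (suc x) + fib (2 + n)    ∎)
    where open ≡-Reasoning

  -- Strong induction on m. A word starting inside a block is extended to the left by the 0 of that
  -- block; desubstitution lowers the period, and the Fibonacci index grows by one on the way back.
  fibPeriod : ∀ m → Acc _<_ m → ∀ i → 1 ≤ m → PeriodicFrom i m → FibPeriod i m
  fibPeriod-start : ∀ m → Acc _<_ m → ∀ a → 2 ≤ m → PeriodicFrom (S a) m → FibPeriod (S a) m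

  fibPeriod (suc zero) _ i _ _ with letter (f i)
  -- Period 1 is `fib 2` when the letter at i is 0 and `fib 1` when it is 1; the equation for S
  -- tells them apart.
  ... | inj₁ e = 1 , refl , trans (cong S (+-comm i 1)) (trans (S-suc e) (+-comm 2 (S i)))
  ... | inj₂ e = 0 , refl , trans (cong S (+-comm i 1)) (trans (S-suc e) (+-comm 1 (S i)))
  fibPeriod m@(suc (suc m′)) rec i _ h with position i
  ... | start a = fibPeriod-start m rec a (s≤s (s≤s z≤n)) h
  ... | inner a e = FibPeriod-shift (f-S a) (before-1 f-i+m) (fibPeriod-start m rec a (s≤s (s≤s z≤n)) h′)
    where
    f-i+m : f (suc (S a + m)) ≡ true
    f-i+m = trans (sym (h (suc (S a)) ≤-refl (linear 1 (z≤n {2 * m′}) (arith (S a) m′)))) (f-next e)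
      where
      arith : ∀ s m → 1 + (3 + (1 + s) + 2 * m) ≡ 1 + s + (2 + m + (2 + m)) + 0
      arith = solve-∀
    h′ : PeriodicFrom (S a) m
    h′ t a≤t t≤ with m≤n⇒m<n∨m≡n a≤t
    ... | inj₁ a<t = h t a<t (m≤n⇒m≤1+n t≤)
    ... | inj₂ refl = trans (f-S a) (sym (before-1 f-i+m))

  fibPeriod-start (suc zero) _ a (s≤s ()) h
  -- The period word is 01: there is a 0 at its start and two letters on, and 000 does not occur.
  fibPeriod-start (suc (suc zero)) _ a _ h = 2 , refl , (begin
    S (S a + 2)          ≡⟨ cong S (+-comm (S a) 2) ⟩
    S (2 + S a)          ≡⟨ S-suc f-i+1 ⟩
    1 + S (1 + S a)      ≡⟨ cong suc (S-suc (f-S a)) ⟩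
    3 + S (S a)          ≡⟨ +-comm 3 (S (S a)) ⟩
    S (S a) + 3          ∎)
    where
    open ≡-Reasoning
    f-i+2 : f (2 + S a) ≡ false
    f-i+2 =
        trans (cong f (+-comm 2 (S a))) (trans (sym (h (S a) ≤-refl (linear 1 (z≤n {0}) (arith (S a))))) (f-S a))
      where
      arith : ∀ s → 1 + (3 + s + 0) ≡ s + 4 + 0
      arith = solve-∀
    f-i+1 : f (1 + S a) ≡ true
    f-i+1 with letter (f (1 + S a))
    ... | inj₁ e = ⊥-elim (false≢true f-i+2 (no-000 (f-S a) e))
    ... | inj₂ e = e
  -- The letter m places after the block start is 0 as well, hence opens a block; the number d of
  -- blocks in between is the smaller period.
  fibPeriod-start m@(suc (suc (suc m′))) (acc rec) a _ h with startOf f-i+m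
    where
    f-i+m : f (S a + m) ≡ false
    f-i+m = trans (sym (h (S a) ≤-refl (linear 0 (z≤n {3 + 2 * m′}) (arith (S a) m′)))) (f-S a)
      where
      arith : ∀ s m → 0 + (3 + s + (3 + 2 * m)) ≡ s + (3 + m + (3 + m)) + 0
      arith = solve-∀
  ... | w , S[w] with m≤n⇒∃[o]m+o≡n (<⇒≤ (S-cancel-< {a} {w} (≤-trans (m<m+n (S a) z<s) (≤-reflexive S[w]))))
  ...   | d , refl with fibPeriod d (rec (d<m d S[w])) a (1≤d d S[w]) (desubstitute a m d (s≤s (s≤s (s≤s z≤n))) h (sym S[w]))
    where
    1≤d : ∀ d → S a + m ≡ S (a + d) → 1 ≤ d
    1≤d zero e =
        ⊥-elim (linear-⊥ (2 + m′) (≤-reflexive (trans e (cong S (+-identityʳ a)))) (arith (S a) m′))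
      where
      arith : ∀ s m → 2 + m + suc s ≡ s + (3 + m)
      arith = solve-∀
    1≤d (suc d) _ = s≤s z≤n
    growth : ∀ d → d + S a ≤ S (a + d)
    growth zero = ≤-reflexive (cong S (sym (+-identityʳ a)))
    growth (suc d) =
        ≤-trans (s≤s (growth d)) (≤-trans (S-step (a + d)) (≤-reflexive (cong S (sym (+-suc a d)))))
    two : ∀ x → 3 + S x ≤ S (2 + x)
    two x with f x in e
    ... | true rewrite no-11 e = ≤-refl
    ... | false = +-monoˡ-≤ (2 + S x) (len-pos (f (suc x)))
    growth₂ : ∀ d → 3 + d + S a ≤ S (a + (2 + d))
    growth₂ zero = ≤-trans (two a) (≤-reflexive (cong S (+-comm 2 a)))
    growth₂ (suc d) =
        ≤-trans (s≤s (growth₂ d)) (≤-trans (S-step (a + (2 + d))) (≤-reflexive (cong S (sym (+-suc a (2 + d))))))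
    d<m : ∀ d → S a + m ≡ S (a + d) → d < m
    d<m zero _ = z<s
    d<m (suc zero) _ = s≤s z<s
    d<m (suc (suc d)) e =
        +-cancelʳ-≤ (S a) _ _ (≤-trans (growth₂ d) (≤-reflexive (trans (sym e) (+-comm (S a) m))))
  ...     | n , d≡ , e = suc n , m≡ , (begin
    S (S a + m)                          ≡⟨ cong S S[w] ⟩
    S (S (a + d))                        ≡⟨ S-S (a + d) ⟩
    S (a + d) + (a + d)                  ≡⟨ cong₂ (λ x y → x + (a + y)) e d≡ ⟩
    S a + fib (2 + n) + (a + fib (1 + n)) ≡⟨ arith (S a) (fib (2 + n)) a (fib (1 + n)) ⟩
    S a + a + fib (3 + n)                ≡⟨ cong (_+ fib (3 + n)) (S-S a) ⟨
    S (S a) + fib (3 + n)                ∎)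
    where
    open ≡-Reasoning
    arith : ∀ a b c d → a + b + (c + d) ≡ a + c + (b + d)
    arith = solve-∀
    m≡ : m ≡ fib (2 + n)
    m≡ = +-cancelˡ-≡ (S a) m (fib (2 + n)) (trans S[w] e)

  -- Cubes in the gaps between differing pairs

  P-0 : ∀ n → 2 + P n 0 ≡ fib (3 + n)
  P-0 n = trans (P-cut n 0) (cong (_+ fib (3 + n)) (S^-0 (2 + n)))

  P-suc-0 : ∀ n {k} → f k ≡ false → P n (suc k) ≡ P n k + fib (4 + n)
  P-suc-0 n {k} e = +-cancelˡ-≡ 2 _ _ (begin
    2 + P n (suc k)                              ≡⟨ P-cut n (suc k) ⟩
    S^ (2 + n) (suc k) + fib (3 + n)             ≡⟨ cong (_+ fib (3 + n)) (S^-suc-0 (2 + n) e) ⟩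
    S^ (2 + n) k + fib (4 + n) + fib (3 + n)     ≡⟨ swap-last (S^ (2 + n) k) (fib (4 + n)) (fib (3 + n)) ⟩
    S^ (2 + n) k + fib (3 + n) + fib (4 + n)     ≡⟨ cong (_+ fib (4 + n)) (P-cut n k) ⟨
    2 + P n k + fib (4 + n)                      ∎)
    where
    open ≡-Reasoning
    swap-last : ∀ a b c → a + b + c ≡ a + c + b
    swap-last = solve-∀

  P-suc-1 : ∀ n {k} → f k ≡ true → P n (suc k) ≡ P n k + fib (3 + n)
  P-suc-1 n {k} e = +-cancelˡ-≡ 2 _ _ (begin
    2 + P n (suc k)                              ≡⟨ P-cut n (suc k) ⟩
    S^ (2 + n) (suc k) + fib (3 + n)             ≡⟨ cong (_+ fib (3 + n)) (S^-suc-1 (2 + n) e) ⟩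
    S^ (2 + n) k + fib (3 + n) + fib (3 + n)     ≡⟨ cong (_+ fib (3 + n)) (P-cut n k) ⟨
    2 + P n k + fib (3 + n)                      ∎)
    where open ≡-Reasoning

  P-step : ∀ n k → P n k < P n (suc k)
  P-step zero k = S-mono-< (S-step k)
  P-step (suc n) k = s≤s (S-mono-< (P-step n k))

  between-matches : ∀ n k {t} → 2 + P n k ≤ t → t < P n (suc k) → f (t + fib (2 + n)) ≡ f t
  between-matches n k {t} lo hi with comparison n t
  ... | matches m = proj₁ m
  ... | first k′ = ⊥-elim (<⇒≱ (P-cancel-< hi) (P-cancel-< (≤-trans (n≤1+n _) lo)))
    where
    P-cancel-< : ∀ {x y} → P n x < P n y → x < y
    P-cancel-< = monotone-cancel-< (P n) (P-step n)
  ... | second k′ = ⊥-elim (<⇒≱ (P-cancel-< (≤-trans (n≤1+n _) hi)) (P-cancel-< (s≤s⁻¹ lo)))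
    where
    P-cancel-< : ∀ {x y} → P n x < P n y → x < y
    P-cancel-< = monotone-cancel-< (P n) (P-step n)

  p-mismatch : ∀ n k → f (P n k) ≢ f (P n k + fib (2 + n))
  p-mismatch n k e = not-¬ refl (trans (sym at-p) (trans e at-q))
    where open Swap (swap n k)

  p₁-mismatch : ∀ n k → f (suc (P n k)) ≢ f (suc (P n k) + fib (2 + n))
  p₁-mismatch n k e = not-¬ refl (trans (sym at-q₁) (trans (sym e) at-p₁))
    where open Swap (swap n k)

  CubeAt : ℕ → Set
  CubeAt j = Σ ℕ λ i → Σ ℕ λ m → (1 ≤ m) × (j + 1 ≡ i + 3 * m) ×
    (∀ t → t < m → (f (i + t) ≡ f (i + m + t)) × (f (i + t) ≡ f (i + 2 * m + t)))

  -- j is the last position of a cube of period F_N, N = 4 + n, lying in the gap between the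
  -- pairs P (2 + n) k and P (2 + n) (suc k); the gap is long enough only if f k ≡ false.
  CubeForm : ℕ → Set
  CubeForm j = ∃ λ n → ∃ λ k → f k ≡ false ×
    S^ (4 + n) (suc k) + (fib (4 + n) + fib (4 + n)) ≤ suc j ×
    3 + j ≤ S^ (4 + n) (suc k) + fib (6 + n)

  -- Two periods fit between neighbouring pairs only in a long gap, where f k is 0 and the room left
  -- is fib (1 + n) - 2; this forces n ≥ 2.
  gap-form : ∀ n k i {j} → 2 + P n k ≤ i → i + (fib (2 + n) + fib (2 + n)) ≤ P n (suc k) →
    suc j ≡ i + 3 * fib (2 + n) → CubeForm j
  gap-form n k i lo hi j≡ with letter (f k)
  ... | inj₂ e = ⊥-elim (linear-⊥ 1
          (lo ⊕ hi ⊕ ≤-reflexive (P-suc-1 n e) ⊕ fib-mono (n≤1+n n))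
          (arith (P n k) i (P n (suc k)) (fib (2 + n)) (fib (1 + n))))
    where
    arith : ∀ p i p′ b a → 1 + suc (i + (p′ + (p + (b + a) + b))) ≡ 2 + p + (i + (b + b) + (p′ + a))
    arith = solve-∀
  gap-form zero k i lo hi j≡ | inj₁ e = ⊥-elim (linear-⊥ 0
          (lo ⊕ hi ⊕ ≤-reflexive (P-suc-0 0 e)) (arith (P 0 k) i (P 0 (suc k))))
    where
    arith : ∀ p i p′ → 0 + suc (i + (p′ + (p + 3))) ≡ 2 + p + (i + 2 + p′)
    arith = solve-∀
  gap-form (suc zero) k i lo hi j≡ | inj₁ e = ⊥-elim (linear-⊥ 0
          (lo ⊕ hi ⊕ ≤-reflexive (P-suc-0 1 e)) (arith (P 1 k) i (P 1 (suc k))))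
    where
    arith : ∀ p i p′ → 0 + suc (i + (p′ + (p + 5))) ≡ 2 + p + (i + 4 + p′)
    arith = solve-∀
  gap-form (suc (suc n)) k i {j} lo hi j≡ | inj₁ e = n , k , e ,
    linear 0 (lo ⊕ ≤-reflexive (sym j≡) ⊕ ≤-reflexive (sym (P-cut (2 + n) k)) ⊕
      ≤-reflexive (S^-suc-0 (4 + n) e))
      (arith₁ (S^ (4 + n) (suc k)) (fib (4 + n)) (fib (3 + n)) i j (P (2 + n) k) (S^ (4 + n) k)) ,
    linear 0 (hi ⊕ ≤-reflexive j≡ ⊕ ≤-reflexive (P-cut (2 + n) (suc k)))
      (arith₂ (S^ (4 + n) (suc k)) (fib (4 + n)) (fib (3 + n)) i j (P (2 + n) (suc k)))
    where
    arith₁ : ∀ A b a i j p B → 0 + (A + (b + b) + (i + (suc j + (2 + p + (B + (b + a + b)))))) ≡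
      suc j + (2 + p + (i + 3 * b + (B + (b + a) + A)))
    arith₁ = solve-∀
    arith₂ : ∀ A b a i j p → 0 + (3 + j + (p + (i + 3 * b + (A + (b + a))))) ≡
      A + (b + a + b) + (i + (b + b) + (suc j + (2 + p)))
    arith₂ = solve-∀

  -- `fibPeriod` makes the period a Fibonacci number. The first two thirds of the cube agree with
  -- their shift by m, so they meet no differing pair and lie in one gap.
  cube⇒form : ∀ {j} → CubeAt j → CubeForm j
  cube⇒form {j} (i , m , 1≤m , j≡ , h) = go (fibPeriod m (<-wellFounded m) i 1≤m
      λ t i≤t t≤ → periodic t i≤t (≤-trans (s≤s (m≤n+m t 2)) t≤))
    where
    periodic : ∀ t → i ≤ t → t < i + (m + m) → f t ≡ f (t + m)
    periodic t i≤t t< with m≤n⇒∃[o]m+o≡n i≤t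
    ... | s , refl with s <? m
    ...   | yes s<m = trans (proj₁ (h s s<m)) (cong f (swap-last i m s))
      where
      swap-last : ∀ a b c → a + b + c ≡ a + c + b
      swap-last = solve-∀
    ...   | no s≮m with m≤n⇒∃[o]m+o≡n (≮⇒≥ s≮m)
    ...     | r , refl = begin
      f (i + (m + r))      ≡⟨ cong f (+-assoc i m r) ⟨
      f (i + m + r)        ≡⟨ proj₁ (h r r<m) ⟨
      f (i + r)            ≡⟨ proj₂ (h r r<m) ⟩
      f (i + 2 * m + r)    ≡⟨ cong f (arith i m r) ⟩
      f (i + (m + r) + m)  ∎
      where
      open ≡-Reasoning
      arith : ∀ i m r → i + 2 * m + r ≡ i + (m + r) + m
      arith = solve-∀
      r<m : r < m
      r<m = +-cancelˡ-< (i + m) r m (subst₂ _<_ (sym (+-assoc i m r)) (sym (+-assoc i m m)) t<)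

    -- A pair with a letter at or after i must start at i + 2m or later. If i is the second letter
    -- of the pair, only the second mismatch is available.
    avoid : ∀ n → m ≡ fib (2 + n) → ∀ k → i < 2 + P n k → i + (m + m) ≤ P n k
    avoid n refl k i<2+p with i + (m + m) ≤? P n k
    ... | yes le = le
    ... | no ≰ with m≤n⇒m<n∨m≡n (s≤s⁻¹ i<2+p)
    ...   | inj₁ i≤p = ⊥-elim (p-mismatch n k (periodic (P n k) (s≤s⁻¹ i≤p) (≰⇒> ≰)))
    ...   | inj₂ refl = ⊥-elim (p₁-mismatch n k (periodic i ≤-refl (m<m+n i (≤-trans 1≤m (m≤m+n m m)))))

    goFib : ∀ n → m ≡ fib (2 + n) → CubeForm j
    goFib n m≡ with locate (λ k → 2 + P n k) (λ k → s≤s (s≤s (P-step n k))) i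
    ... | inj₂ (k , lo , hi) =
            gap-form n k i lo (subst (λ m → i + (m + m) ≤ P n (suc k)) m≡ (avoid n m≡ (suc k) hi))
            (trans (+-comm 1 j) (trans j≡ (cong (λ m → i + 3 * m) m≡)))
    -- The first pair starts at fib (3 + n) - 2, too early for two periods before it.
    ... | inj₁ lt = ⊥-elim (linear-⊥ (1 + i)
            (subst (λ m → i + (m + m) ≤ P n 0) m≡ (avoid n m≡ 0 lt) ⊕ ≤-reflexive (P-0 n) ⊕
              fib-mono (n≤1+n n))
            (arith i (P n 0) (fib (2 + n)) (fib (1 + n))))
      where
      arith : ∀ i p b a → 1 + i + suc (p + (b + a + b)) ≡ i + (b + b) + (2 + p + a)
      arith = solve-∀

    go : FibPeriod i m → CubeForm j
    -- `fib 1` and `fib 2` are both 1.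
    go (zero , m≡ , _) = goFib 0 m≡
    go (suc n , m≡ , _) = goFib n m≡

  -- The bounds place the first two copies inside the gap, where f agrees with its shift by m; using
  -- this once and twice gives the second and third copy.
  form⇒cube : ∀ {j} → CubeForm j → CubeAt j
  form⇒cube {j} (n , k , e , lo , hi) = i , m , fib-pos (3 + n) , trans (+-comm j 1) (sym i≡) , λ t t<m →
      sym (trans (cong f (swap-last i m t)) (match (i + t) (m≤m+n i t) (+-monoʳ-< i (≤-trans t<m (m≤m+n m m))))) ,
      sym (trans (cong f (arith₄ i m t)) (trans (match (i + m + t) (≤-trans (m≤m+n i m) (m≤m+n (i + m) t))
             (≤-trans (+-monoʳ-< (i + m) t<m) (≤-reflexive (+-assoc i m m))))
           (trans (cong f (swap-last i m t)) (match (i + t) (m≤m+n i t) (+-monoʳ-< i (≤-trans t<m (m≤m+n m m)))))))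
    where
    m = fib (4 + n)
    -- The subtraction is exact by `3m≤`, since A is at least `S^ (4 + n) 1`, which is fib (6 + n).
    i = suc j ∸ 3 * m
    A = S^ (4 + n) (suc k)
    3m≤ : 3 * m ≤ suc j
    3m≤ =
        linear (fib (5 + n)) (lo ⊕ ≤-reflexive (sym (S^-1 (4 + n))) ⊕ S^-mono (4 + n) {1} {suc k} (s≤s z≤n))
      (arith (fib (4 + n)) (fib (3 + n)) j A (S^ (4 + n) 1))
      where
      arith : ∀ b a j A B → b + a + (3 * b + (suc j + (B + A))) ≡ suc j + (A + (b + b) + (b + a + b + B))
      arith = solve-∀
    i≡ : i + 3 * m ≡ suc j
    i≡ = m∸n+n≡m 3m≤
    lo′ : 2 + P (2 + n) k ≤ i
    lo′ =
        linear 0 (lo ⊕ ≤-reflexive (sym i≡) ⊕ ≤-reflexive (P-cut (2 + n) k) ⊕ ≤-reflexive (sym (S^-suc-0 (4 + n) e)))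
      (arith (P (2 + n) k) A (fib (4 + n)) (fib (3 + n)) i j (S^ (4 + n) k))
      where
      arith : ∀ p A b a i j B → 0 + (2 + p + (suc j + (i + 3 * b + (B + (b + a) + A)))) ≡
        i + (A + (b + b) + (suc j + (2 + p + (B + (b + a + b)))))
      arith = solve-∀
    hi′ : i + (m + m) ≤ P (2 + n) (suc k)
    hi′ = linear 0 (hi ⊕ ≤-reflexive i≡ ⊕ ≤-reflexive (sym (P-cut (2 + n) (suc k))))
      (arith (P (2 + n) (suc k)) A (fib (4 + n)) (fib (3 + n)) i j)
      where
      arith : ∀ p A b a i j → 0 + (i + (b + b) + (A + (b + a + b) + (suc j + (2 + p)))) ≡
        p + (3 + j + (i + 3 * b + (A + (b + a))))
      arith = solve-∀
    match : ∀ t → i ≤ t → t < i + (m + m) → f (t + m) ≡ f t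
    match t i≤t t< = between-matches (2 + n) k (≤-trans lo′ i≤t) (≤-trans t< hi′)
    swap-last : ∀ a b c → a + b + c ≡ a + c + b
    swap-last = solve-∀
    arith₄ : ∀ i m t → i + 2 * m + t ≡ i + m + t + m
    arith₄ = solve-∀

  -- Cube ends next to cuts, and windows without any

  last-cube : ∀ n k {j} → f k ≡ false → 3 + j ≡ S^ (4 + n) (suc k) + fib (6 + n) → CubeForm j
  last-cube n k {j} e j≡ = n , k , e ,
    -- The two bounds of `CubeForm` leave a margin of fib (3 + n) - 2.
    linear 0 (≤-reflexive (sym j≡) ⊕ fib-mono {2} {2 + n} (s≤s (s≤s z≤n)))
      (arith (S^ (4 + n) (suc k)) (fib (4 + n)) (fib (3 + n)) j) ,
    ≤-reflexive j≡
    where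
    arith : ∀ A b a j → 0 + (A + (b + b) + (3 + j + a)) ≡ suc j + (A + (b + a + b) + 2)
    arith = solve-∀

  predecessor : ∀ {k} → f k ≡ true → ∃ λ κ → k ≡ suc κ × f κ ≡ false
  predecessor {zero} e = ⊥-elim (false≢true f0 e)
  predecessor {suc κ} e = κ , refl , before-1 e

  -- The first 0 of a factor 00 is the block of a 1, and this 1 is preceded by a 0.
  before-00 : ∀ {k} → f k ≡ false → f (suc k) ≡ false → ∃ λ κ →
    k ≡ S (suc κ) × f (suc κ) ≡ true × f κ ≡ false
  before-00 e e₁ with startOf e
  ... | z , refl with letter (f z)
  ...   | inj₁ h = ⊥-elim (false≢true e₁ (f-next h))
  ...   | inj₂ h with predecessor h
  ...     | κ , refl , h₀ = κ , refl , h , h₀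

  -- The 1 lies in the block of a 0 at `suc y`. If f y is 1, the last cube of period fib (4 + n) in
  -- a gap ends at j; if f y is 0, the factor 00 desubstitutes further and the period is fib (6 +
  -- n).
  cube-before-01 : ∀ n a {j} → f (2 + a) ≡ true → 3 + j ≡ S^ (4 + n) (2 + a) → CubeForm j
  cube-before-01 n a {j} e j≡ with innerOf e
  ... | suc y , a≡ , fy with letter (f y)
  ...   | inj₂ fy₀ = last-cube n (S y) (f-S y) (begin
      3 + j                                          ≡⟨ j≡ ⟩
      S^ (4 + n) (2 + a)                             ≡⟨ cong (S^ (4 + n)) 2+a≡ ⟩
      S^ (4 + n) (2 + S y)                           ≡⟨ S^-suc-0 (4 + n) (trans (cong f (sym (suc-injective 2+a≡))) (before-1 e)) ⟩
      S^ (4 + n) (suc (S y)) + fib (6 + n)           ∎)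
      where
      open ≡-Reasoning
      2+a≡ : 2 + a ≡ 2 + S y
      2+a≡ = trans a≡ (cong suc (S-suc fy₀))
  ...   | inj₁ fy₀ with before-00 fy₀ fy
  ...     | κ , refl , fκ₁ , fκ = last-cube (2 + n) κ fκ (begin
      3 + j                                          ≡⟨ j≡ ⟩
      S^ (4 + n) (2 + a)                             ≡⟨ cong (S^ (4 + n)) (trans a≡ (cong suc (S-suc fy₀))) ⟩
      S^ (4 + n) (3 + S (S (suc κ)))                 ≡⟨ S^-suc-0 (4 + n) (no-11 (f-next fy₀)) ⟩
      S^ (4 + n) (2 + S (S (suc κ))) + fib (6 + n)
        ≡⟨ cong (_+ fib (6 + n)) (S^-suc-1 (4 + n) (f-next fy₀)) ⟩
      S^ (4 + n) (suc (S (S (suc κ)))) + fib (5 + n) + fib (6 + n)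
        ≡⟨ cong (λ x → x + fib (5 + n) + fib (6 + n)) (S^-suc-0 (4 + n) (f-S (S (suc κ)))) ⟩
      S^ (4 + n) (S (S (suc κ))) + fib (6 + n) + fib (5 + n) + fib (6 + n)
        ≡⟨ cong (λ x → x + fib (6 + n) + fib (5 + n) + fib (6 + n)) (trans (S^-S (4 + n) (S (suc κ))) (S^-S (5 + n) (suc κ))) ⟩
      S^ (6 + n) (suc κ) + fib (6 + n) + fib (5 + n) + fib (6 + n)
        ≡⟨ arith (S^ (6 + n) (suc κ)) (fib (6 + n)) (fib (5 + n)) ⟩
      S^ (6 + n) (suc κ) + fib (8 + n)               ∎)
      where
      open ≡-Reasoning
      arith : ∀ A c b → A + c + b + c ≡ A + (c + b + c)
      arith = solve-∀

  -- A cut to the left of a 0 is also a cut one level higher, so one descends to a cut 0|1.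
  cube-before-cut : ∀ n k → Acc _<_ k → ∀ {j} → 3 + j ≡ S^ (4 + n) (suc k) →
    (∃ λ M → S^ (4 + n) (suc k) ≡ fib (6 + M)) ⊎ CubeForm j
  cube-before-cut n k (acc rec) j≡ with letter (f (suc k))
  -- The first positive cut of a level is the exception, being a Fibonacci number.
  cube-before-cut n zero _ j≡ | inj₂ e = inj₁ (n , S^-1 (4 + n))
  cube-before-cut n (suc k) _ j≡ | inj₂ e = inj₂ (cube-before-01 n k e j≡)
  cube-before-cut n k (acc rec) j≡ | inj₁ e with startOf e
  ... | suc y , k≡ = subst (λ q → (∃ λ M → q ≡ fib (6 + M)) ⊎ _) (sym cut≡)
          (cube-before-cut (suc n) y (rec y<k) (trans j≡ cut≡))
    where
    y<k : y < k
    y<k = s≤s⁻¹ (≤-trans (S-expanding (suc y) (s≤s z≤n)) (≤-reflexive (sym k≡)))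
    cut≡ : S^ (4 + n) (suc k) ≡ S^ (5 + n) (suc y)
    cut≡ = trans (cong (S^ (4 + n)) k≡) (S^-S (4 + n) (suc y))

  -- The last cube of period 3 in the gap of the preceding 0 ends 8 - 3 = 5 places after `S^ 4 k`,
  -- and φ^4(1) has length 5.
  cube-after-1 : ∀ {k} → f k ≡ true → CubeForm (S^ 4 (suc k))
  cube-after-1 e with predecessor e
  ... | κ , refl , e₀ = last-cube 0 κ e₀ (trans (cong (3 +_) (S^-suc-1 4 e)) (arith (S^ 4 (suc κ))))
    where
    arith : ∀ A → 3 + (A + 5) ≡ A + 8
    arith = solve-∀

  -- The period is 5. The cut is 8 places after `S^ 5 (suc κ)`, so this is the leftmost end that the
  -- lower bound admits.
  cube-after-00 : ∀ {k} → f k ≡ false → f (suc k) ≡ false → CubeForm (suc (S^ 4 (suc k)))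
  cube-after-00 e e₁ with before-00 e e₁
  ... | κ , refl , fκ₁ , fκ = 1 , κ , fκ ,
        linear 0 (≤-reflexive (sym cut≡)) (arith₁ A B) ,
        linear 1 (≤-reflexive cut≡) (arith₂ A B)
    where
    A = S^ 5 (suc κ)
    B = S^ 4 (suc (S (suc κ)))
    cut≡ : B ≡ A + 8
    cut≡ = trans (trans (cong (S^ 4) (sym (S-suc fκ₁))) (S^-S 4 (2 + κ))) (S^-suc-1 5 fκ₁)
    arith₁ : ∀ A B → 0 + (A + 10 + B) ≡ suc (suc B) + (A + 8)
    arith₁ = solve-∀
    arith₂ : ∀ A B → 1 + (3 + suc B + (A + 8)) ≡ A + 13 + B
    arith₂ = solve-∀

  -- Take the first cut after 2 + i. If it is at most 9 + i, the place three before it lies in the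
  -- window and `cube-before-cut` applies. Otherwise a block of length 8 starts exactly at 2 + i,
  -- and a cube ends there or one place later, depending on the letter before.
  cube-free-window : ∀ i → (∀ j → i ≤ j → j ≤ 6 + i → CubeForm j → ⊥) →
    ∃ λ M → 3 + i ≤ fib (6 + M) × fib (6 + M) ≤ 9 + i
  cube-free-window i free with locate (S^ 4) (S^-step 4) (2 + i)
  ... | inj₂ (k , lo , hi) with S^ 4 (suc k) ≤? 9 + i
  ...   | yes q≤ with m≤n⇒∃[o]m+o≡n (≤-trans (s≤s (s≤s (s≤s z≤n))) hi)
  ...     | j , j≡ with cube-before-cut 0 k (<-wellFounded k) j≡
  ...       | inj₁ (M , q≡) = M , ≤-trans hi (≤-reflexive q≡) , ≤-trans (≤-reflexive (sym q≡)) q≤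
  ...       | inj₂ c = ⊥-elim (free j
                (+-cancelˡ-≤ 3 i j (≤-trans hi (≤-reflexive (sym j≡))))
                (+-cancelˡ-≤ 3 j (6 + i) (≤-trans (≤-reflexive j≡) q≤)) c)
  cube-free-window i free | inj₂ (k , lo , hi) | no q≰ with letter (f k)
  ... | inj₂ e =
          ⊥-elim (linear-⊥ 2 (lo ⊕ ≰⇒> q≰ ⊕ ≤-reflexive (S^-suc-1 4 e)) (arith (S^ 4 k) (S^ 4 (suc k)) i))
    where
    arith : ∀ A B i → 2 + suc (2 + i + (B + (A + 5))) ≡ A + (suc (9 + i) + B)
    arith = solve-∀
  ... | inj₁ e = ⊥-elim (contradict k e cut≡)
    where
    cut≡ : S^ 4 k ≡ 2 + i
    cut≡ =
        ≤-antisym lo (linear 0 (≰⇒> q≰ ⊕ ≤-reflexive (S^-suc-0 4 e)) (arith (S^ 4 k) (S^ 4 (suc k)) i))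
      where
      arith : ∀ A B i → 0 + (2 + i + (B + (A + 8))) ≡ A + (suc (9 + i) + B)
      arith = solve-∀
    contradict : ∀ k → f k ≡ false → S^ 4 k ≡ 2 + i → ⊥
    contradict zero _ ()
    contradict (suc k) e q≡ with letter (f k)
    ... | inj₂ e′ =
            free (2 + i) (m≤n+m i 2) (+-monoˡ-≤ i (s≤s (s≤s (z≤n {4})))) (subst CubeForm q≡ (cube-after-1 e′))
    ... | inj₁ e′ = free (3 + i) (m≤n+m i 3) (+-monoˡ-≤ i (s≤s (s≤s (s≤s (z≤n {3})))))
                      (subst (CubeForm ∘ suc) q≡ (cube-after-00 e′ e))

  -- Cube ends around Fibonacci numbers

  S^4-fib : ∀ n → S^ 4 (2 + P (suc n) 0) ≡ fib (8 + n)
  S^4-fib n = trans (cong (S^ 4) (P-0 (suc n))) (S^-fib 4 (2 + n))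

  -- The first pair of level `suc n` ends at fib (4 + n), which four applications of S carry to fib
  -- (8 + n). If it is 10, j is the cut between its letters' images, just after a 1; if 01, that cut
  -- is j + 3 and precedes a 1.
  cube-before-fib : ∀ n {j} → 8 + j ≡ fib (8 + n) → CubeForm j
  cube-before-fib n {j} j≡ with letter (par (suc n))
  ... | inj₂ e = subst CubeForm (+-cancelʳ-≡ 8 _ j (begin
        S^ 4 (suc p) + 8    ≡⟨ S^-suc-0 4 (trans at-p₁ (cong not e)) ⟨
        S^ 4 (2 + p)        ≡⟨ S^4-fib n ⟩
        fib (8 + n)         ≡⟨ j≡ ⟨
        8 + j               ≡⟨ +-comm 8 j ⟩
        j + 8               ∎)) (cube-after-1 (trans at-p e))
    where
    open ≡-Reasoning
    open Swap (swap (suc n) 0)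
  ... | inj₁ e = cube-before-01 0 (S (P n 0)) p₁≡true (+-cancelʳ-≡ 5 _ _ (begin
        3 + j + 5           ≡⟨ +-comm (3 + j) 5 ⟩
        8 + j               ≡⟨ j≡ ⟩
        fib (8 + n)         ≡⟨ S^4-fib n ⟨
        S^ 4 (2 + p)        ≡⟨ S^-suc-1 4 p₁≡true ⟩
        S^ 4 (suc p) + 5    ∎))
    where
    open ≡-Reasoning
    open Swap (swap (suc n) 0)
    p₁≡true : f (suc p) ≡ true
    p₁≡true = trans at-p₁ (cong not e)

  cube-at-fib : ∀ n → par (suc n) ≡ false → CubeForm (fib (8 + n))
  cube-at-fib n e = subst CubeForm (S^4-fib n) (cube-after-1 (trans at-p₁ (cong not e)))
    where open Swap (swap (suc n) 0)

  -- The pair is 10 and the letter after it opens a block, so the cut separates the images of a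
  -- factor 00.
  cube-after-fib : ∀ n → par (suc n) ≡ true → CubeForm (suc (fib (8 + n)))
  cube-after-fib n e = subst (CubeForm ∘ suc) (S^4-fib n)
    (cube-after-00 (trans at-p₁ (cong not e)) (trans (cong f cut) (f-S (S (S^ n 1)))))
    where
    open Swap (swap (suc n) 0)
    cut : 2 + P (suc n) 0 ≡ S^ (2 + n) 1
    cut = trans (P-0 (suc n)) (sym (S^-1 (2 + n)))

  -- The first cut and the shortest period give fib 6 + 2 fib 4 = 14 ≤ suc j.
  no-small-cube : ∀ {j} → CubeForm j → 13 ≤ j
  no-small-cube {j} (n , k , _ , lo , _) = linear 0
    (lo ⊕ S^-mono (4 + n) {1} {suc k} (s≤s z≤n) ⊕ ≤-reflexive (sym (S^-1 (4 + n))) ⊕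
      fib-mono {5} {5 + n} (m≤m+n 5 n) ⊕ fib-mono {3} {3 + n} (m≤m+n 3 n) ⊕
        fib-mono {3} {3 + n} (m≤m+n 3 n))
    (arith (S^ (4 + n) (suc k)) (S^ (4 + n) 1) (fib (6 + n)) (fib (4 + n)) j)
    where
    arith : ∀ A B c b j → 0 + (13 + (suc j + (A + (B + (c + (b + b)))))) ≡
      j + (A + (b + b) + (B + (c + (8 + (3 + 3)))))
    arith = solve-∀

  -- The place fib (8 + n) is included for the parity in which the zeros extend over it.
  At-most-fib : ℕ → ℕ → Set
  At-most-fib n j = j < fib (8 + n) ⊎ (j ≡ fib (8 + n) × par (suc n) ≡ true)

  at-most-fib : ∀ {n j} → At-most-fib n j → j ≤ fib (8 + n)
  at-most-fib (inj₁ j<q) = <⇒≤ j<q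
  at-most-fib (inj₂ (j≡q , _)) = ≤-reflexive j≡q

  -- The period would be fib (4 + l). For l > n even the leftmost such cube ends too far right; for
  -- l ≤ n the Fibonacci number is the cut `S^ L (2 + p)`, and the gap k is compared with p.
  no-cube-before-fib : ∀ n {j} → fib (8 + n) ≤ 7 + j → At-most-fib n j → CubeForm j → ⊥
  no-cube-before-fib n {j} q≤ j-pos (l , k , fk , lo , hi) with l ≤? n
  ... | no l≰n = linear-⊥ 0
      (lo ⊕ S^-mono (4 + l) {1} {suc k} (s≤s z≤n) ⊕ ≤-reflexive (sym (S^-1 (4 + l))) ⊕
        fib-mono (+-monoʳ-≤ 5 n<l) ⊕ fib-mono (+-monoʳ-≤ 3 n<l) ⊕ fib-mono (+-monoʳ-≤ 3 n<l) ⊕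
        at-most-fib {n} {j} j-pos ⊕ fib-mono {2} {2 + n} (s≤s (s≤s z≤n)))
      (arith (S^ (4 + l) (suc k)) (S^ (4 + l) 1) (fib (6 + l)) (fib (4 + l)) (fib (4 + n)) (fib (3 + n)) j)
    where
    n<l : suc n ≤ l
    n<l = ≰⇒> l≰n
    arith : ∀ A B c d b a j →
      0 + suc (suc j + (A + (B + (c + (d + (d + (b + a + b + (b + a) + (b + a + b) + a))))))) ≡
      A + (d + d) + (B + (c + (b + a + b + (b + a) + (b + a + (b + a + (j + 2))))))
    arith = solve-∀
  ... | yes l≤n with m≤n⇒∃[o]m+o≡n l≤n
  ...   | d , refl = contradict (<-cmp k p)
    where
    open Swap (swap (suc d) 0)
    L = 4 + l
    Q = fib (8 + (l + d))

    cut : S^ L (2 + p) ≡ Q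
    cut = trans (cong (S^ L) (P-0 (suc d))) (trans (S^-fib L (2 + d))
      (cong (λ x → fib (6 + x)) (trans (+-suc l (suc d)) (cong suc (+-suc l d)))))

    fib-L : 5 ≤ fib (suc L)
    fib-L = fib-mono {4} {4 + l} (m≤m+n 4 l)

    short-block : ∀ x → 5 + S^ L x ≤ S^ L (suc x)
    short-block x = ≤-trans (≤-reflexive (+-comm 5 (S^ L x))) (grow (letter (f x)))
      where
      grow : f x ≡ false ⊎ f x ≡ true → S^ L x + 5 ≤ S^ L (suc x)
      grow (inj₁ e) =
          ≤-trans (+-monoʳ-≤ (S^ L x) (fib-mono {4} {5 + l} (m≤m+n 4 (suc l)))) (≤-reflexive (sym (S^-suc-0 L e)))
      grow (inj₂ e) = ≤-trans (+-monoʳ-≤ (S^ L x) fib-L) (≤-reflexive (sym (S^-suc-1 L e)))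

    contradict : Tri (k < p) (k ≡ p) (p < k) → ⊥
    contradict (tri> _ _ p<k) = linear-⊥ 4
      (S^-mono L (s≤s p<k) ⊕ ≤-reflexive (sym cut) ⊕ lo ⊕ at-most-fib {l + d} {j} j-pos ⊕
        fib-mono {3} {3 + l} (m≤m+n 3 l) ⊕ fib-mono {3} {3 + l} (m≤m+n 3 l))
      (arith (S^ L (2 + p)) (S^ L (suc k)) Q (fib L) j)
      where
      arith : ∀ C A Q b j →
        4 + suc (A + (C + (suc j + (Q + (b + b))))) ≡ C + (Q + (A + (b + b) + (j + (3 + 3))))
      arith = solve-∀
    -- At least 5 places lie between the upper bound for 3 + j and Q, so j is at most Q - 8.
    contradict (tri< k<p _ _) with letter (f (suc k))
    ... | inj₁ e = linear-⊥ 0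
      (hi ⊕ ≤-reflexive (sym (S^-suc-0 L e)) ⊕ S^-mono L (s≤s k<p) ⊕ short-block (suc p) ⊕
        ≤-reflexive cut ⊕ q≤)
      (arith (S^ L (suc k)) (S^ L (2 + k)) (S^ L (suc p)) (S^ L (2 + p)) Q (fib (2 + L)) j)
      where
      arith : ∀ A B C D Q c j → 0 + suc (A + c + (B + (C + (D + (Q + (7 + j)))))) ≡
        3 + j + (A + c + (B + (5 + C + (D + Q))))
      arith = solve-∀
    ... | inj₂ e = linear-⊥ 0
      (hi ⊕ ≤-reflexive (sym (S^-suc-1 L e)) ⊕ ≤-reflexive (sym (S^-suc-0 L (no-11 e))) ⊕
        S^-mono L (s≤s (s≤s k<p)) ⊕ ≤-reflexive cut ⊕ q≤ ⊕ fib-L)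
      (arith (S^ L (suc k)) (S^ L (2 + k)) (S^ L (3 + k)) (S^ L (2 + p)) Q (fib (2 + L)) (fib (suc L)) j)
      where
      arith : ∀ A B C D Q c b j → 0 + suc (A + c + (B + (C + (D + (Q + (7 + j + b)))))) ≡
        3 + j + (A + b + (B + c + (C + (D + (Q + 5)))))
      arith = solve-∀
    -- The lower bound becomes suc j ≥ Q + fib (2 + l): only j = Q with l = 0 could remain, which
    -- the parity excludes.
    contradict (tri≈ _ refl _) = at-cut j-pos
      where
      par≡false : par (suc d) ≡ false
      par≡false = trans (sym at-p) fk
      Q≤ : Q + fib (2 + l) ≤ suc j
      Q≤ =
          linear 0 (lo ⊕ ≤-reflexive (sym cut) ⊕ ≤-reflexive (S^-suc-1 L (trans at-p₁ (cong not par≡false))))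
        (arith (S^ L (suc p)) (S^ L (2 + p)) Q (fib (2 + l)) (fib (3 + l)) j)
        where
        arith : ∀ A B Q a b j → 0 + (Q + a + (suc j + (B + (A + (b + a + b))))) ≡
          suc j + (A + (b + a + (b + a)) + (Q + B))
        arith = solve-∀
      at-cut : At-most-fib (l + d) j → ⊥
      at-cut (inj₁ j<Q) = linear-⊥ 0 (Q≤ ⊕ j<Q ⊕ fib-pos (suc l)) (arith Q (fib (2 + l)) j)
        where
        arith : ∀ Q a j → 0 + suc (suc j + (Q + a)) ≡ Q + a + (suc j + 1)
        arith = solve-∀
      at-cut (inj₂ (j≡Q , e)) = l-pos l refl
        where
        l-pos : ∀ l′ → l′ ≡ l → ⊥
        l-pos zero refl = false≢true par≡false e
        l-pos (suc l′) refl = linear-⊥ 0 (Q≤ ⊕ ≤-reflexive j≡Q ⊕ fib-mono {2} {2 + l′} (m≤m+n 2 l′))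
          (arith Q (fib (3 + l′)) j)
          where
          arith : ∀ Q a j → 0 + suc (suc j + (Q + a)) ≡ Q + a + (j + 2)
          arith = solve-∀

  -- Runs of zeros of length 7 and 8

  par-cases : ∀ n → ∃ λ k → (n ≡ k + k × par n ≡ false) ⊎ (n ≡ suc (k + k) × par n ≡ true)
  par-cases zero = 0 , inj₁ (refl , refl)
  par-cases (suc n) with par-cases n
  ... | k , inj₁ (n≡ , e) = k , inj₂ (cong suc n≡ , cong not e)
  ... | k , inj₂ (n≡ , e) = suc k , inj₁ (cong suc (trans n≡ (sym (+-suc k k))) , cong not e)

  par-double : ∀ k → par (k + k) ≡ false
  par-double zero = refl
  par-double (suc k) rewrite +-suc k k | par-double k = refl

  module Runs (u : ℕ → Bool) (u⇔cube : ∀ n → (u n ≡ true) ⇔ CubeAt n) where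

    true⇒form : ∀ {j} → u j ≡ true → CubeForm j
    true⇒form e = cube⇒form (Equivalence.to (u⇔cube _) e)

    form⇒true : ∀ {j} → CubeForm j → u j ≡ true
    form⇒true c = Equivalence.from (u⇔cube _) (form⇒cube c)

    no-form⇒false : ∀ {j} → (CubeForm j → ⊥) → u j ≡ false
    no-form⇒false h = ≢true⇒false (h ∘ true⇒form)

    -- Seven zeros force a Fibonacci number Q nearby. As a cube ends at p, just before the run, Q ≥
    -- 8 + p; as one ends at Q - 8, Q ≤ 8 + p.
    run-start : ∀ ℓ i → 7 ≤ ℓ → ℓ ≤ 8 → RunOfZeros u ℓ i → ∃ λ n → 7 + i ≡ fib (8 + n)
    run-start ℓ _ _ ℓ≤8 (_ , end , inj₁ refl) =
      ⊥-elim (<⇒≱ (≤-trans (m≤m+n 9 4) (no-small-cube (true⇒form end))) ℓ≤8)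
    run-start ℓ _ 7≤ℓ _ (zeros , _ , inj₂ (p , refl , up)) = result (cube-free-window (suc p) free)
      where
      free : ∀ j → suc p ≤ j → j ≤ 7 + p → CubeForm j → ⊥
      free j i≤j j≤ c with m≤n⇒∃[o]m+o≡n i≤j
      ... | t , refl = false≢true
              (zeros t (≤-trans (+-cancelˡ-≤ (suc p) (suc t) 7 (linear 0 j≤ (arith p t))) 7≤ℓ)) (form⇒true c)
        where
        arith : ∀ p t → 0 + (suc p + suc t + (7 + p)) ≡ suc p + 7 + (suc p + t)
        arith = solve-∀
      13≤p : 13 ≤ p
      13≤p = no-small-cube (true⇒form up)

      result : (∃ λ M → 4 + p ≤ fib (6 + M) × fib (6 + M) ≤ 10 + p) → ∃ λ n → 8 + p ≡ fib (8 + n)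
      -- `fib 6` and `fib 7` are too small, since p is at least 13.
      result (0 , lo , _) = ⊥-elim (<⇒≱ (≤-trans (m≤m+n 9 8) (+-monoʳ-≤ 4 13≤p)) lo)
      result (1 , lo , _) = ⊥-elim (<⇒≱ (≤-trans (m≤m+n 14 3) (+-monoʳ-≤ 4 13≤p)) lo)
      result (suc (suc n) , lo , hi) = n , ≤-antisym 8+p≤q q≤8+p
        where
        8+p≤q : 8 + p ≤ fib (8 + n)
        8+p≤q = ≰⇒> λ q≤ → no-cube-before-fib n q≤ (inj₁ (≤-trans (m≤n+m (suc p) 3) lo)) (true⇒form up)
        q≤8+p : fib (8 + n) ≤ 8 + p
        q≤8+p = ≮⇒≥ λ q> → contradict q> (m≤n⇒∃[o]m+o≡n 8+p≤q)
          where
          contradict : 8 + p < fib (8 + n) → (∃ λ r → 8 + p + r ≡ fib (8 + n)) → ⊥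
          contradict q> (r , q≡) = free (p + r)
            (+-cancelˡ-≤ 8 _ _ (≤-trans q> (≤-reflexive (sym q≡))))
            (+-cancelˡ-≤ 8 _ _ (≤-trans (≤-reflexive q≡) (≤-trans hi (+-monoˡ-≤ p (m≤m+n 10 5)))))
            (cube-before-fib n q≡)

    run-zeros : ∀ n i → 7 + i ≡ fib (8 + n) → ∀ t → t < 7 → u (i + t) ≡ false
    run-zeros n i i≡ t t<7 = no-form⇒false (no-cube-before-fib n
      (≤-trans (≤-reflexive (sym i≡)) (+-monoʳ-≤ 7 (m≤m+n i t)))
      (inj₁ (≤-trans (+-monoʳ-< i t<7) (≤-reflexive (trans (+-comm i 7) i≡)))))

    run-left : ∀ n i → 7 + i ≡ fib (8 + n) → i ≡ 0 ⊎ Σ ℕ λ p → i ≡ suc p × u p ≡ true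
    run-left n zero _ = inj₁ refl
    run-left n (suc p) i≡ = inj₂ (p , refl , form⇒true (cube-before-fib n i≡))

    -- Let Q = 7 + i = fib (8 + n). For even n no cube ends at Q but one ends at Q + 1; for odd n
    -- one ends at Q.
    run-8 : ∀ i → RunOfZeros u 8 i ⇔ (∃ λ k → 7 + i ≡ fib (8 + (k + k)))
    run-8 i = mk⇔ to from
      where
      to : RunOfZeros u 8 i → ∃ λ k → 7 + i ≡ fib (8 + (k + k))
      to run@(zeros , _ , _) with run-start 8 i (n≤1+n 7) ≤-refl run
      ... | n , i≡ with par-cases n
      ...   | k , inj₁ (refl , _) = k , i≡
      ...   | _ , inj₂ (_ , e) = ⊥-elim (false≢true
                (trans (cong u (trans (sym i≡) (+-comm 7 i))) (zeros 7 ≤-refl)) (form⇒true (cube-at-fib n (cong not e))))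
      from : (∃ λ k → 7 + i ≡ fib (8 + (k + k))) → RunOfZeros u 8 i
      from (k , i≡) =
          zeros , trans (cong u (trans (+-comm i 8) (cong suc i≡))) (form⇒true (cube-after-fib (k + k) odd)) , run-left (k + k) i i≡
        where
        odd : par (suc (k + k)) ≡ true
        odd = cong not (par-double k)
        i+7≡ : i + 7 ≡ fib (8 + (k + k))
        i+7≡ = trans (+-comm i 7) i≡
        zeros : ∀ t → t < 8 → u (i + t) ≡ false
        zeros t t<8 with m≤n⇒m<n∨m≡n (s≤s⁻¹ t<8)
        ... | inj₁ t<7 = run-zeros (k + k) i i≡ t t<7
        ... | inj₂ refl = no-form⇒false (no-cube-before-fib (k + k)
                (≤-trans (≤-reflexive (sym i+7≡)) (m≤n+m (i + 7) 7)) (inj₂ (i+7≡ , odd)))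

    run-7 : ∀ i → RunOfZeros u 7 i ⇔ (∃ λ k → 7 + i ≡ fib (9 + (k + k)))
    run-7 i = mk⇔ to from
      where
      to : RunOfZeros u 7 i → ∃ λ k → 7 + i ≡ fib (9 + (k + k))
      to run@(_ , end , _) with run-start 7 i ≤-refl (n≤1+n 7) run
      ... | n , i≡ with par-cases n
      ...   | k , inj₂ (refl , _) = k , i≡
      ...   | _ , inj₁ (_ , e) = ⊥-elim (no-cube-before-fib n
                (≤-trans (≤-reflexive (sym i+7≡)) (m≤n+m (i + 7) 7)) (inj₂ (i+7≡ ,
                  cong not e)) (true⇒form end))
        where
        i+7≡ : i + 7 ≡ fib (8 + n)
        i+7≡ = trans (+-comm i 7) i≡
      from : (∃ λ k → 7 + i ≡ fib (9 + (k + k))) → RunOfZeros u 7 i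
      from (k , i≡) = run-zeros (suc (k + k)) i i≡ ,
        trans (cong u (trans (+-comm i 7) i≡)) (form⇒true (cube-at-fib (suc (k + k)) (cong (not ∘ not) (par-double k)))) ,
        run-left (suc (k + k)) i i≡

-- The Fibonacci word as a fixed point of φ

φ-++ : ∀ u v → φ (u ++ v) ≡ φ u ++ φ v
φ-++ [] v = refl
φ-++ (false ∷ u) v = cong (λ w → false ∷ true ∷ w) (φ-++ u v)
φ-++ (true ∷ u) v = cong (false ∷_) (φ-++ u v)

iter-++ : ∀ n u v → iter n (u ++ v) ≡ iter n u ++ iter n v
iter-++ zero u v = refl
iter-++ (suc n) u v = trans (cong φ (iter-++ n u v)) (φ-++ (iter n u) (iter n v))

iter-φ : ∀ n w → iter n (φ w) ≡ φ (iter n w)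
iter-φ zero w = refl
iter-φ (suc n) w = cong φ (iter-φ n w)

at-++ : ∀ u v {n} → n < length u → at (u ++ v) n ≡ at u n
at-++ (x ∷ u) v {zero} _ = refl
at-++ (x ∷ u) v {suc n} n< = at-++ u v (s≤s⁻¹ n<)

prefix : ℕ → List Bool
prefix n = iter n (false ∷ [])

prefix-suc : ∀ n → prefix (suc n) ≡ prefix n ++ iter n (true ∷ [])
prefix-suc n = trans (sym (iter-φ n (false ∷ []))) (iter-++ n (false ∷ []) (true ∷ []))

length-φ : ∀ w → length w ≤ length (φ w)
length-φ [] = z≤n
length-φ (false ∷ w) = s≤s (m≤n⇒m≤1+n (length-φ w))
length-φ (true ∷ w) = s≤s (length-φ w)

length-iter-pos : ∀ n → 1 ≤ length (iter n (true ∷ []))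
length-iter-pos zero = ≤-refl
length-iter-pos (suc n) = ≤-trans (length-iter-pos n) (length-φ (iter n (true ∷ [])))

length-prefix : ∀ n → n < length (prefix n)
length-prefix zero = ≤-refl
length-prefix (suc n) = begin
  suc (suc n)                                           ≡⟨ +-comm 1 (suc n) ⟩
  suc n + 1                                             ≤⟨ +-mono-≤ (length-prefix n) (length-iter-pos n) ⟩
  length (prefix n) + length (iter n (true ∷ []))       ≡⟨ length-++ (prefix n) ⟨
  length (prefix n ++ iter n (true ∷ []))               ≡⟨ cong length (prefix-suc n) ⟨
  length (prefix (suc n))                               ∎
  where open ≤-Reasoning

at-prefix : ∀ {n} N → n < N → at (prefix N) n ≡ fibWord n
at-prefix {n} N n<N = go (≤⇒≤′ n<N)
  where
  go : ∀ {N} → suc n ≤′ N → at (prefix N) n ≡ fibWord n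
  go ≤′-refl = refl
  go (≤′-step {N} p) = trans (cong (λ w → at w n) (prefix-suc N))
    (trans (at-++ (prefix N) _ (<-trans (≤′⇒≤ p) (length-prefix N))) (go p))

blockStart-∷ : ∀ x w n → blockStart (at (x ∷ w)) (suc n) ≡ len x + blockStart (at w) n
blockStart-∷ x w zero = refl
blockStart-∷ x w (suc n) =
    trans (cong (len (at w n) +_) (blockStart-∷ x w n)) (arith (len (at w n)) (len x) (blockStart (at w) n))
  where
  arith : ∀ a b c → a + (b + c) ≡ b + (a + c)
  arith = solve-∀

at-φ : ∀ w {n} → n < length w →
  at (φ w) (blockStart (at w) n) ≡ false ×
  (at w n ≡ false → at (φ w) (suc (blockStart (at w) n)) ≡ true)
at-φ (false ∷ w) {zero} _ = refl , λ _ → refl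
at-φ (true ∷ w) {zero} _ = refl , λ ()
at-φ (x ∷ w) {suc n} n< rewrite blockStart-∷ x w n = lemma x (at-φ w (s≤s⁻¹ n<))
  where
  lemma : ∀ x {s} {P : Set} → at (φ w) s ≡ false × (P → at (φ w) (suc s) ≡ true) →
    at (φ (x ∷ w)) (len x + s) ≡ false × (P → at (φ (x ∷ w)) (suc (len x + s)) ≡ true)
  lemma false h = h
  lemma true h = h

blockStart-cong : ∀ {f g n} → (∀ t → t < n → f t ≡ g t) → blockStart f n ≡ blockStart g n
blockStart-cong {n = zero} _ = refl
blockStart-cong {n =
    suc n} h = cong₂ _+_ (cong len (h n ≤-refl)) (blockStart-cong λ t t<n → h t (m≤n⇒m≤1+n t<n))

blockStart-≤ : ∀ f n → blockStart f n ≤ n + n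
blockStart-≤ f zero = z≤n
blockStart-≤ f (suc n) =
    ≤-trans (+-mono-≤ (len-≤2 (f n)) (blockStart-≤ f n)) (≤-reflexive (cong suc (sym (+-suc n n))))
  where
  len-≤2 : ∀ b → len b ≤ 2
  len-≤2 false = ≤-refl
  len-≤2 true = s≤s z≤n

fibWord-φ : ∀ n → fibWord (blockStart fibWord n) ≡ false ×
  (fibWord n ≡ false → fibWord (suc (blockStart fibWord n)) ≡ true)
fibWord-φ n =
    trans (sym (at-prefix (suc N) s<N)) (subst (λ s → at (prefix (suc N)) s ≡ false) block≡ (proj₁ image)) ,
  λ e → trans (sym (at-prefix (suc N) (s≤s s<N′)))
    (subst (λ s → at (prefix (suc N)) (suc s) ≡ true) block≡ (proj₂ image (trans (at-prefix N n<N) e)))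
  where
  -- Block starts satisfy `blockStart fibWord n ≤ n + n`, so this index covers n and its block.
  N = suc (n + n)
  n<N : n < N
  n<N = s≤s (m≤m+n n n)
  image = at-φ (prefix N) (<-trans n<N (length-prefix N))
  block≡ : blockStart (at (prefix N)) n ≡ blockStart fibWord n
  block≡ = blockStart-cong λ t t<n → at-prefix N (<-trans t<n n<N)
  s<N′ : blockStart fibWord n < N
  s<N′ = s≤s (blockStart-≤ fibWord n)
  s<N : blockStart fibWord n < suc N
  s<N = m≤n⇒m≤1+n s<N′

-- Values of the digit words (10)^k s

length-rep10 : ∀ k s → length (rep10 k ++ s) ≡ length s + (k + k)
length-rep10 zero s = sym (+-identityʳ (length s))
length-rep10 (suc k) s = trans (cong (2 +_) (length-rep10 k s)) (arith (length s) k)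
  where
  arith : ∀ l k → 2 + (l + (k + k)) ≡ l + (suc k + suc k)
  arith = solve-∀

-- For a word of length l and value fib (2 + l) - c, prepending 10 adds fib (3 + l), which gives fib
-- (4 + l) - c.
val-rep10 : ∀ c s → c + val s ≡ fib (2 + length s) →
  ∀ k → c + val (rep10 k ++ s) ≡ fib (2 + length s + (k + k))
val-rep10 c s base zero = trans base (cong (λ l → fib (2 + l)) (sym (+-identityʳ (length s))))
val-rep10 c s base (suc k) = begin
  c + (fib (suc (length w) + 2) + val w)      ≡⟨ arith c (fib (suc (length w) + 2)) (val w) ⟩
  fib (suc (length w) + 2) + (c + val w)      ≡⟨ cong₂ _+_ (cong fib top) (val-rep10 c s base k) ⟩
  fib (4 + l)                                 ≡⟨ cong (λ n → fib (2 + n)) (shift (length s) k) ⟩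
  fib (2 + length s + (suc k + suc k))        ∎
  where
  open ≡-Reasoning
  w = rep10 k ++ s
  l = length s + (k + k)
  top : suc (length w) + 2 ≡ 3 + l
  top = trans (cong (λ n → suc n + 2) (length-rep10 k s)) (+-comm (suc l) 2)
  arith : ∀ a b c → a + (b + c) ≡ b + (a + c)
  arith = solve-∀
  shift : ∀ l k → 2 + (l + (k + k)) ≡ l + (suc k + suc k)
  shift = solve-∀

no11-rep10 : ∀ k s → No11 s → No11 (rep10 k ++ s)
no11-rep10 zero s h = h
no11-rep10 (suc k) s h = prepend (rep10 k ++ s) (no11-rep10 k s h)
  where
  prepend : ∀ w → No11 w → No11 (false ∷ w)
  prepend [] _ = tt
  prepend (_ ∷ _) h = h

repIn10+ : ∀ c s → No11 s → c + val s ≡ fib (2 + length s) →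
  ∀ i → RepIn10+ s i ⇔ (∃ λ k → c + i ≡ fib (4 + length s + (k + k)))
repIn10+ c s no11 base i = mk⇔ to from
  where
  index : ∀ l k → 2 + l + (suc k + suc k) ≡ 4 + l + (k + k)
  index = solve-∀
  to : RepIn10+ s i → ∃ λ k → c + i ≡ fib (4 + length s + (k + k))
  to (_ , (_ , _ , refl) , suc k , _ , refl) =
      k , trans (val-rep10 c s base (suc k)) (cong fib (index (length s) k))
  from : (∃ λ k → c + i ≡ fib (4 + length s + (k + k))) → RepIn10+ s i
  from (k , i≡) = rep10 (suc k) ++ s ,
    (refl , no11-rep10 (suc k) s no11 ,
      +-cancelˡ-≡ c _ _ (trans (val-rep10 c s base (suc k)) (trans (cong fib (index (length s) k)) (sym i≡)))) ,
    suc k , s≤s z≤n , refl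

-- Specialisation to the Fibonacci word

open Structure fibWord refl (proj₁ ∘ fibWord-φ) (λ k → proj₂ (fibWord-φ k))

theorem3 : (cubesF : ℕ → Bool) →
    (∀ n → (cubesF n ≡ true) ⇔ CubeEndsAt n) →
    (∀ i → RunOfZeros cubesF 8 i ⇔ RepIn10+ suffix8 i) ×
    (∀ i → RunOfZeros cubesF 7 i ⇔ RepIn10+ suffix7 i)
theorem3 cubesF cubesF⇔cube =
  -- The words 0001 and 01001 have values 1 and 6; adding 7 gives 8 = fib 6 and 13 = fib 7.
  (λ i → ⇔-sym (repIn10+ 7 suffix8 tt refl i) ⇔-∘ run-8 i) ,
  (λ i → ⇔-sym (repIn10+ 7 suffix7 tt refl i) ⇔-∘ run-7 i)
  where open Runs cubesF cubesF⇔cube
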